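{- A graph $H$ is $i$-graph realizable if and only if each of its blocks is $i$-graph realizable.
   Context: All graphs are finite and simple. A block of a graph is a maximal connected subgraph without a cut vertex. For a graph $G$, $i(G)$ denotes the minimum cardinality of an independent dominating set of $G$; an independent dominating set of cardinality $i(G)$ is an $i$-set of $G$. The $i$-graph $\mathcal{I}(G)$ of $G$ is the graph whose vertices are the $i$-sets of $G$, where two $i$-sets $S$ and $S'$ are adjacent if and only if there is an edge $xy\in E(G)$ with $S'=(S-\{x\})\cup\{y\}$. A graph $H$ is $i$-graph realizable (is an $i$-graph) if there exists a graph $G$ with $\mathcal{I}(G)\cong H$. -}

module Defs where

open import Data.Nat using (ℕ; _≤_)
open import Data.Bool using (Bool; true; false; T)
open import Data.Fin using (Fin)
open import Data.Fin.Subset using (Subset; _∈_; _∉_; _⊆_; _-_; _∪_; ⁅_⁆; ∣_∣)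
open import Data.Product using (Σ; ∃; ∃-syntax; _×_; _,_)
open import Data.Sum using (_⊎_)
open import Relation.Nullary using (¬_)
open import Relation.Binary.PropositionalEquality using (_≡_)
open import Function.Bundles using (_⇔_)
open import Level using (0ℓ)

record Graph : Set where
  field
    n      : ℕ
    adj    : Fin n → Fin n → Bool
    sym    : ∀ x y → adj x y ≡ adj y x
    irrefl : ∀ x → adj x x ≡ false

  E : Fin n → Fin n → Set
  E x y = T (adj x y)

open Graph public

module _ (G : Graph) where

  Independent : Subset (n G) → Set
  Independent S = ∀ x y → x ∈ S → y ∈ S → ¬ E G x y

  Dominating : Subset (n G) → Set
  Dominating S = ∀ v → v ∈ S ⊎ (∃[ u ] (u ∈ S × E G u v))

  IndepDom : Subset (n G) → Set
  IndepDom S = Independent S × Dominating S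

  IsISet : Subset (n G) → Set
  IsISet S = IndepDom S × (∀ T → IndepDom T → ∣ S ∣ ≤ ∣ T ∣)

  ISetAdj : Subset (n G) → Subset (n G) → Set
  ISetAdj S S' = ∃[ x ] ∃[ y ] (E G x y × x ∈ S × y ∉ S × S' ≡ (S - x) ∪ ⁅ y ⁆)

-- The subgraph H[B] induced by a vertex set B is isomorphic to I(G):
-- a map f from the vertices of B to subsets of V(G), which is a bijection
-- from B onto the set of i-sets of G and preserves/reflects adjacency.

IGraphIsoOn : (H : Graph) → Subset (n H) → (G : Graph) → Set
IGraphIsoOn H B G =
  Σ (Fin (n H) → Subset (n G)) λ f →
      (∀ v → v ∈ B → IsISet G (f v))
    × (∀ u v → u ∈ B → v ∈ B → f u ≡ f v → u ≡ v)
    × (∀ S → IsISet G S → ∃[ v ] (v ∈ B × f v ≡ S))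
    × (∀ u v → u ∈ B → v ∈ B → E H u v ⇔ ISetAdj G (f u) (f v))

IRealizableOn : (H : Graph) → Subset (n H) → Set
IRealizableOn H B = ∃[ G ] IGraphIsoOn H B G

IRealizable : Graph → Set
IRealizable H = ∃[ G ] IGraphIsoOn H Data.Fin.Subset.⊤ G

data PathIn (H : Graph) (B : Subset (n H)) : Fin (n H) → Fin (n H) → Set where
  here : ∀ {x} → x ∈ B → PathIn H B x x
  step : ∀ {x y z} → x ∈ B → E H x y → PathIn H B y z → PathIn H B x z

ConnectedOn : (H : Graph) → Subset (n H) → Set
ConnectedOn H B = (∃[ v ] v ∈ B) × (∀ x y → x ∈ B → y ∈ B → PathIn H B x y)

NoCutVertexOn : (H : Graph) → Subset (n H) → Set
NoCutVertexOn H B =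
  ∀ v → v ∈ B → ∀ x y → x ∈ (B - v) → y ∈ (B - v) → PathIn H (B - v) x y

Nonseparable : (H : Graph) → Subset (n H) → Set
Nonseparable H B = ConnectedOn H B × NoCutVertexOn H B

-- a block: a maximal vertex set inducing a connected subgraph without a
-- cut vertex (maximal subgraphs with this property are induced)
IsBlock : (H : Graph) → Subset (n H) → Set
IsBlock H B = Nonseparable H B × (∀ C → B ⊆ C → Nonseparable H C → C ≡ B)

{-# OPTIONS --safe #-}
-- The Cartesian product of two i-graphs is the i-graph of a disjoint union, and
-- every nonempty induced subgraph of an i-graph is an i-graph. Two i-graphs
-- glued at one vertex, or put side by side, form an induced subgraph of a
-- product of i-graphs, so H is assembled by splitting it at cut vertices and
-- between components until only nonseparable pieces, contained in blocks, remain.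
module Submission where

open import Defs
open import Data.Bool using (Bool; true; false; T; not; _xor_)
open import Data.Bool.Properties using (T?)
import Data.Bool.Properties as Bool
open import Data.Empty using (⊥-elim)
open import Data.Fin using (Fin; zero; suc; splitAt; _↑ˡ_; _↑ʳ_; _≟_; fromℕ<)
open import Data.Fin.Properties
  using (any?; all?; splitAt-↑ˡ; splitAt-↑ʳ; splitAt⁻¹-↑ˡ; splitAt⁻¹-↑ʳ)
open import Data.Fin.Subset
open import Data.Fin.Subset.Induction using (⊂-wellFounded; ⊃-wellFounded; Acc; acc)
open import Data.Fin.Subset.Properties
open import Data.List using (List; filter; length)
import Data.List as List
open import Data.List.Membership.Propositional renaming (_∈_ to _∈ᴸ_) using ()
open import Data.List.Membership.Propositional.Properties
  using (∈-map⁺; ∈-++⁺ˡ; ∈-++⁺ʳ; ∈-filter⁺; ∈-filter⁻; ∈-lookup)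
open import Data.List.Relation.Unary.Any using (index; here; there)
open import Data.List.Relation.Unary.Any.Properties using (lookup-index)
open import Data.Nat using (ℕ; _+_; _≤_; _<_; _≥_; _≤?_)
open import Data.Nat.Properties
  using ( ≤-trans; ≤-reflexive; ≤-<-trans; <⇒≤; <⇒≱; +-comm; +-identityʳ; +-mono-≤; +-monoʳ-≤
        ; module ≤-Reasoning)
open import Data.Product using (Σ; ∃; ∃-syntax; _×_; _,_; proj₁; proj₂)
open import Data.Sum using (_⊎_; inj₁; inj₂; [_,_]′)
open import Data.Unit using (tt)
open import Data.Vec using ([]; _∷_; _++_; here; there; lookup)
import Data.Vec as Vec
open import Data.Vec.Properties
  using (zipWith-++; ++-injective; []=⇒lookup; lookup⇒[]=; ≡-dec)
open import Function using (_∘_; id)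
open import Function.Bundles using (_⇔_; mk⇔; module Equivalence)
open import Relation.Binary.PropositionalEquality as ≡
  using (_≡_; _≢_; refl; cong; cong₂; subst; trans)
open import Relation.Nullary using (¬_; Dec; yes; no; ¬?; contradiction)
open import Relation.Nullary.Decidable
  using (_×-dec_; _⊎-dec_; _→-dec_; map′; from-yes; from-no; decidable-stable)

open Equivalence using (to; from)

-- Elementary facts on graphs and finite subsets.

loopless : ∀ G x → ¬ E G x x
loopless G x xx = subst T (irrefl G x) xx

E-sym : ∀ G x y → E G x y → E G y x
E-sym G x y = subst T (sym G x y)

x∈p─q⇒x∉q : ∀ {k} {p q : Subset k} {x} → x ∈ p ─ q → x ∉ q
x∈p─q⇒x∉q {p = _ ∷ _} {q = _ ∷ _} (there x∈) (there x∈q) = x∈p─q⇒x∉q x∈ x∈q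
x∈p─q⇒x∉q {p = _ ∷ _} {q = true ∷ _} () here

x∈p-y⇒x≢y : ∀ {k} {p : Subset k} {x y} → x ∈ p - y → x ≢ y
x∈p-y⇒x≢y x∈ refl = x∈p─q⇒x∉q x∈ (x∈⁅x⁆ _)

_≟ˢ_ : ∀ {k} (S T : Subset k) → Dec (S ≡ T)
_≟ˢ_ = ≡-dec Bool._≟_

p⊆q∧∣q∣≤∣p∣⇒p≡q : ∀ {k} {p q : Subset k} → p ⊆ q → ∣ q ∣ ≤ ∣ p ∣ → p ≡ q
p⊆q∧∣q∣≤∣p∣⇒p≡q {p = p} {q} p⊆q ∣q∣≤∣p∣ = ⊆-antisym p⊆q q⊆p
  where
  q⊆p : q ⊆ p
  q⊆p {x} x∈q = decidable-stable (x ∈? p) λ x∉p →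
    <⇒≱ (p⊂q⇒∣p∣<∣q∣ (p⊆q , x , x∈q , x∉p)) ∣q∣≤∣p∣

nonempty⇒1≤∣p∣ : ∀ {k} {p : Subset k} {x} → x ∈ p → 1 ≤ ∣ p ∣
nonempty⇒1≤∣p∣ {p = p} {x} x∈p = subst (_≤ ∣ p ∣) (∣⁅x⁆∣≡1 x)
  (p⊆q⇒∣p∣≤∣q∣ λ y∈ → subst (_∈ p) (≡.sym (x∈⁅y⁆⇒x≡y x y∈)) x∈p)

subsets : ∀ k → List (Subset k)
subsets ℕ.zero    = List.[ [] ]
subsets (ℕ.suc k) = List.map (true ∷_) (subsets k) List.++ List.map (false ∷_) (subsets k)

∈-subsets : ∀ {k} (S : Subset k) → S ∈ᴸ subsets k
∈-subsets []          = here refl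
∈-subsets (true ∷ S)  = ∈-++⁺ˡ (∈-map⁺ (true ∷_) (∈-subsets S))
∈-subsets (false ∷ S) = ∈-++⁺ʳ (List.map (true ∷_) (subsets _)) (∈-map⁺ (false ∷_) (∈-subsets S))

-- Indexing by `Fin l` lets sets serve as vertices of a graph: each unwanted i-set will receive one
-- new vertex.
enumerate : ∀ {k} {P : Subset k → Set} → (∀ S → Dec (P S)) →
  ∃[ l ] Σ (Fin l → Subset k) λ X → (∀ j → P (X j)) × (∀ S → P S → ∃[ j ] S ≡ X j)
enumerate {k} P? = length L , List.lookup L
  , (λ j → proj₂ (∈-filter⁻ P? {xs = subsets k} (∈-lookup {xs = L} j)))
  , (λ S pS → let S∈L = ∈-filter⁺ P? (∈-subsets S) pS in index S∈L , lookup-index S∈L)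
  where
  L : List (Subset k)
  L = filter P? (subsets k)

-- Subsets of a disjoint union of vertex sets.

data SplitView {a b} : Fin (a + b) → Set where
  left  : ∀ i → SplitView (i ↑ˡ b)
  right : ∀ j → SplitView (a ↑ʳ j)

splitView : ∀ {a b} (x : Fin (a + b)) → SplitView {a} {b} x
splitView {a} x with splitAt a x in eq
... | inj₁ i = subst SplitView (splitAt⁻¹-↑ˡ eq) (left i)
... | inj₂ j = subst SplitView (splitAt⁻¹-↑ʳ eq) (right j)

∈-++ˡ⁺ : ∀ {a b} {S : Subset a} {Z : Subset b} {i} → i ∈ S → i ↑ˡ b ∈ S ++ Z
∈-++ˡ⁺ here      = here
∈-++ˡ⁺ (there p) = there (∈-++ˡ⁺ p)

∈-++ˡ⁻ : ∀ {a b} (S : Subset a) {Z : Subset b} {i} → i ↑ˡ b ∈ S ++ Z → i ∈ S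
∈-++ˡ⁻ (_ ∷ S) {i = zero}  here      = here
∈-++ˡ⁻ (_ ∷ S) {i = suc i} (there p) = there (∈-++ˡ⁻ S p)

∈-++ʳ⁺ : ∀ {a b} (S : Subset a) {Z : Subset b} {j} → j ∈ Z → a ↑ʳ j ∈ S ++ Z
∈-++ʳ⁺ []      p = p
∈-++ʳ⁺ (_ ∷ S) p = there (∈-++ʳ⁺ S p)

∈-++ʳ⁻ : ∀ {a b} (S : Subset a) {Z : Subset b} {j} → a ↑ʳ j ∈ S ++ Z → j ∈ Z
∈-++ʳ⁻ []      p         = p
∈-++ʳ⁻ (_ ∷ S) (there p) = ∈-++ʳ⁻ S p

∣++∣ : ∀ {a b} (S : Subset a) (Z : Subset b) → ∣ S ++ Z ∣ ≡ ∣ S ∣ + ∣ Z ∣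
∣++∣ []          Z = refl
∣++∣ (true ∷ S)  Z = cong ℕ.suc (∣++∣ S Z)
∣++∣ (false ∷ S) Z = ∣++∣ S Z

⊥-++ : ∀ a {b} → ⊥ {a + b} ≡ ⊥ {a} ++ ⊥
⊥-++ ℕ.zero    = refl
⊥-++ (ℕ.suc a) = cong (false ∷_) (⊥-++ a)

⁅↑ˡ⁆ : ∀ {a} b (i : Fin a) → ⁅ i ↑ˡ b ⁆ ≡ ⁅ i ⁆ ++ ⊥
⁅↑ˡ⁆ {ℕ.suc a} b zero    = cong (true ∷_) (⊥-++ a)
⁅↑ˡ⁆ {ℕ.suc a} b (suc i) = cong (false ∷_) (⁅↑ˡ⁆ b i)

⁅↑ʳ⁆ : ∀ a {b} (j : Fin b) → ⁅ a ↑ʳ j ⁆ ≡ ⊥ {a} ++ ⁅ j ⁆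
⁅↑ʳ⁆ ℕ.zero    j = refl
⁅↑ʳ⁆ (ℕ.suc a) j = cong (false ∷_) (⁅↑ʳ⁆ a j)

swap : ∀ {k} → Subset k → Fin k → Fin k → Subset k
swap S x y = (S - x) ∪ ⁅ y ⁆

y∈swap : ∀ {k} (S : Subset k) x y → y ∈ swap S x y
y∈swap S x y = q⊆p∪q (S - x) _ (x∈⁅x⁆ y)

-- This is the form a swap takes on the half of a concatenation that contains neither moved vertex.
∪-⊥ : ∀ {k} (S : Subset k) → (S ─ ⊥) ∪ ⊥ ≡ S
∪-⊥ S = trans (∪-identityʳ (S ─ ⊥)) (p─⊥≡p S)

─-++ : ∀ {a b} (S S′ : Subset a) {Z Z′ : Subset b} → (S ++ Z) ─ (S′ ++ Z′) ≡ (S ─ S′) ++ (Z ─ Z′)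
─-++ []      []           = refl
─-++ (x ∷ S) (true ∷ S′)  = cong (false ∷_) (─-++ S S′)
─-++ (x ∷ S) (false ∷ S′) = cong (x ∷_) (─-++ S S′)

module _ {a b} (S : Subset a) (Z : Subset b) where

  swap-++ˡ : ∀ x y → swap (S ++ Z) (x ↑ˡ b) (y ↑ˡ b) ≡ swap S x y ++ Z
  swap-++ˡ x y rewrite ⁅↑ˡ⁆ b x | ⁅↑ˡ⁆ b y | ─-++ S ⁅ x ⁆ {Z} {⊥} =
    trans (zipWith-++ _ (S - x) _ ⁅ y ⁆ ⊥) (cong (swap S x y ++_) (∪-⊥ Z))

  swap-++ʳ : ∀ x y → swap (S ++ Z) (a ↑ʳ x) (a ↑ʳ y) ≡ S ++ swap Z x y
  swap-++ʳ x y rewrite ⁅↑ʳ⁆ a x | ⁅↑ʳ⁆ a y | ─-++ S ⊥ {Z} {⁅ x ⁆} =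
    trans (zipWith-++ _ (S ─ ⊥) _ ⊥ ⁅ y ⁆) (cong (_++ swap Z x y) (∪-⊥ S))

-- Two graphs joined by prescribed cross edges.

module Join (G₁ G₂ : Graph) (c : Fin (n G₁) → Fin (n G₂) → Bool) where

  private
    a = n G₁
    b = n G₂

  -- A constantly false `c` gives the disjoint union, used for products; destroying i-sets uses a
  -- nontrivial `c`.
  adj⊎ : Fin a ⊎ Fin b → Fin a ⊎ Fin b → Bool
  adj⊎ (inj₁ i) (inj₁ i′) = adj G₁ i i′
  adj⊎ (inj₁ i) (inj₂ j)  = c i j
  adj⊎ (inj₂ j) (inj₁ i)  = c i j
  adj⊎ (inj₂ j) (inj₂ j′) = adj G₂ j j′

  adj⊎-sym : ∀ x y → adj⊎ x y ≡ adj⊎ y x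
  adj⊎-sym (inj₁ i) (inj₁ i′) = sym G₁ i i′
  adj⊎-sym (inj₁ i) (inj₂ j)  = refl
  adj⊎-sym (inj₂ j) (inj₁ i)  = refl
  adj⊎-sym (inj₂ j) (inj₂ j′) = sym G₂ j j′

  adj⊎-irrefl : ∀ x → adj⊎ x x ≡ false
  adj⊎-irrefl (inj₁ i) = irrefl G₁ i
  adj⊎-irrefl (inj₂ j) = irrefl G₂ j

  J : Graph
  J = record
    { n      = a + b
    ; adj    = λ x y → adj⊎ (splitAt a x) (splitAt a y)
    ; sym    = λ x y → adj⊎-sym (splitAt a x) (splitAt a y)
    ; irrefl = λ x → adj⊎-irrefl (splitAt a x)
    }

  -- Adjacency in `J` computes only once `splitAt` is resolved, so edges are transported along
  -- equalities of types.
  E-ˡˡ : ∀ i i′ → E J (i ↑ˡ b) (i′ ↑ˡ b) ≡ E G₁ i i′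
  E-ˡˡ i i′ = cong₂ (λ x y → T (adj⊎ x y)) (splitAt-↑ˡ a i b) (splitAt-↑ˡ a i′ b)

  E-ˡʳ : ∀ i j → E J (i ↑ˡ b) (a ↑ʳ j) ≡ T (c i j)
  E-ˡʳ i j = cong₂ (λ x y → T (adj⊎ x y)) (splitAt-↑ˡ a i b) (splitAt-↑ʳ a b j)

  E-ʳˡ : ∀ i j → E J (a ↑ʳ j) (i ↑ˡ b) ≡ T (c i j)
  E-ʳˡ i j = cong₂ (λ x y → T (adj⊎ x y)) (splitAt-↑ʳ a b j) (splitAt-↑ˡ a i b)

  E-ʳʳ : ∀ j j′ → E J (a ↑ʳ j) (a ↑ʳ j′) ≡ E G₂ j j′
  E-ʳʳ j j′ = cong₂ (λ x y → T (adj⊎ x y)) (splitAt-↑ʳ a b j) (splitAt-↑ʳ a b j′)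

  module _ {S : Subset a} {Z : Subset b} where

    independent⁺ : Independent G₁ S → Independent G₂ Z →
      (∀ i j → i ∈ S → j ∈ Z → ¬ T (c i j)) → Independent J (S ++ Z)
    independent⁺ indS indZ cross x y x∈ y∈ xy
      with splitView {a} {b} x | splitView {a} {b} y
    ... | left i  | left i′  = indS i i′ (∈-++ˡ⁻ S x∈) (∈-++ˡ⁻ S y∈) (subst id (E-ˡˡ i i′) xy)
    ... | left i  | right j  = cross i j (∈-++ˡ⁻ S x∈) (∈-++ʳ⁻ S y∈) (subst id (E-ˡʳ i j) xy)
    ... | right j | left i   = cross i j (∈-++ˡ⁻ S y∈) (∈-++ʳ⁻ S x∈) (subst id (E-ʳˡ i j) xy)
    ... | right j | right j′ = indZ j j′ (∈-++ʳ⁻ S x∈) (∈-++ʳ⁻ S y∈) (subst id (E-ʳʳ j j′) xy)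

    independentˡ : Independent J (S ++ Z) → Independent G₁ S
    independentˡ ind i i′ i∈ i′∈ e =
      ind _ _ (∈-++ˡ⁺ i∈) (∈-++ˡ⁺ i′∈) (subst id (≡.sym (E-ˡˡ i i′)) e)

    independentʳ : Independent J (S ++ Z) → Independent G₂ Z
    independentʳ ind j j′ j∈ j′∈ e =
      ind _ _ (∈-++ʳ⁺ S j∈) (∈-++ʳ⁺ S j′∈) (subst id (≡.sym (E-ʳʳ j j′)) e)

    independent-cross : Independent J (S ++ Z) → ∀ {i j} → i ∈ S → j ∈ Z → ¬ T (c i j)
    independent-cross ind {i} {j} i∈ j∈ e =
      ind _ _ (∈-++ˡ⁺ i∈) (∈-++ʳ⁺ S j∈) (subst id (≡.sym (E-ˡʳ i j)) e)

    dominating⁺ :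
      (∀ i → (i ∈ S ⊎ (∃[ u ] (u ∈ S × E G₁ u i))) ⊎ (∃[ j ] (j ∈ Z × T (c i j)))) →
      (∀ j → (j ∈ Z ⊎ (∃[ u ] (u ∈ Z × E G₂ u j))) ⊎ (∃[ i ] (i ∈ S × T (c i j)))) →
      Dominating J (S ++ Z)
    dominating⁺ domˡ domʳ x with splitView {a} {b} x
    ... | left i with domˡ i
    ...   | inj₁ (inj₁ i∈)           = inj₁ (∈-++ˡ⁺ i∈)
    ...   | inj₁ (inj₂ (u , u∈ , e)) = inj₂ (_ , ∈-++ˡ⁺ u∈ , subst id (≡.sym (E-ˡˡ u i)) e)
    ...   | inj₂ (j , j∈ , e)        = inj₂ (_ , ∈-++ʳ⁺ S j∈ , subst id (≡.sym (E-ʳˡ i j)) e)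
    dominating⁺ domˡ domʳ x | right j with domʳ j
    ...   | inj₁ (inj₁ j∈)           = inj₁ (∈-++ʳ⁺ S j∈)
    ...   | inj₁ (inj₂ (u , u∈ , e)) = inj₂ (_ , ∈-++ʳ⁺ S u∈ , subst id (≡.sym (E-ʳʳ u j)) e)
    ...   | inj₂ (i , i∈ , e)        = inj₂ (_ , ∈-++ˡ⁺ i∈ , subst id (≡.sym (E-ˡʳ i j)) e)

    dominatingˡ : Dominating J (S ++ Z) →
      ∀ i → (i ∈ S ⊎ (∃[ u ] (u ∈ S × E G₁ u i))) ⊎ (∃[ j ] (j ∈ Z × T (c i j)))
    dominatingˡ dom i with dom (i ↑ˡ b)
    ... | inj₁ i∈ = inj₁ (inj₁ (∈-++ˡ⁻ S i∈))
    ... | inj₂ (u , u∈ , e) with splitView {a} {b} u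
    ...   | left i′ = inj₁ (inj₂ (i′ , ∈-++ˡ⁻ S u∈ , subst id (E-ˡˡ i′ i) e))
    ...   | right j = inj₂ (j , ∈-++ʳ⁻ S u∈ , subst id (E-ʳˡ i j) e)

    dominatingʳ : Dominating J (S ++ Z) →
      ∀ j → (j ∈ Z ⊎ (∃[ u ] (u ∈ Z × E G₂ u j))) ⊎ (∃[ i ] (i ∈ S × T (c i j)))
    dominatingʳ dom j with dom (a ↑ʳ j)
    ... | inj₁ j∈ = inj₁ (inj₁ (∈-++ʳ⁻ S j∈))
    ... | inj₂ (u , u∈ , e) with splitView {a} {b} u
    ...   | left i   = inj₂ (i , ∈-++ˡ⁻ S u∈ , subst id (E-ˡʳ i j) e)
    ...   | right j′ = inj₁ (inj₂ (j′ , ∈-++ʳ⁻ S u∈ , subst id (E-ʳʳ j′ j) e))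

  iSetAdj-++ˡ : ∀ {S S′ Z} → ISetAdj G₁ S S′ → ISetAdj J (S ++ Z) (S′ ++ Z)
  iSetAdj-++ˡ {S} {S′} {Z} (x , y , e , x∈ , y∉ , refl) =
    x ↑ˡ b , y ↑ˡ b , subst id (≡.sym (E-ˡˡ x y)) e , ∈-++ˡ⁺ x∈ , y∉ ∘ ∈-++ˡ⁻ S , ≡.sym (swap-++ˡ S Z x y)

  iSetAdj-++ʳ : ∀ {S Z Z′} → ISetAdj G₂ Z Z′ → ISetAdj J (S ++ Z) (S ++ Z′)
  iSetAdj-++ʳ {S} {Z} (x , y , e , x∈ , y∉ , refl) =
    a ↑ʳ x , a ↑ʳ y , subst id (≡.sym (E-ʳʳ x y)) e , ∈-++ʳ⁺ S x∈ , y∉ ∘ ∈-++ʳ⁻ S , ≡.sym (swap-++ʳ S Z x y)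

  -- A move within one side leaves the other part unchanged. A move along a cross edge leaves or
  -- enters the second side, so its endpoint there lies in `Z` or `Z′`; this is impossible if `c` is
  -- false or both parts are empty.
  iSetAdj-++⁻ : ∀ {S S′ Z Z′} → ISetAdj J (S ++ Z) (S′ ++ Z′) →
    ((ISetAdj G₁ S S′ × Z ≡ Z′) ⊎ (S ≡ S′ × ISetAdj G₂ Z Z′)) ⊎
    (∃[ i ] ∃[ j ] (T (c i j) × (j ∈ Z ⊎ j ∈ Z′)))
  iSetAdj-++⁻ {S} {S′} {Z} {Z′} (x , y , e , x∈ , y∉ , eq)
    with splitView {a} {b} x | splitView {a} {b} y
  ... | left i  | left i′  =
    let eqˡ , eqʳ = ++-injective S′ (swap S i i′) (trans eq (swap-++ˡ S Z i i′))
    in inj₁ (inj₁ ((i , i′ , subst id (E-ˡˡ i i′) e , ∈-++ˡ⁻ S x∈ , y∉ ∘ ∈-++ˡ⁺ , eqˡ) , ≡.sym eqʳ))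
  ... | right j | right j′ =
    let eqˡ , eqʳ = ++-injective S′ S (trans eq (swap-++ʳ S Z j j′))
    in inj₁ (inj₂ (≡.sym eqˡ , (j , j′ , subst id (E-ʳʳ j j′) e , ∈-++ʳ⁻ S x∈ , y∉ ∘ ∈-++ʳ⁺ S , eqʳ)))
  ... | right j | left i   = inj₂ (i , j , subst id (E-ʳˡ i j) e , inj₁ (∈-++ʳ⁻ S x∈))
  ... | left i  | right j  = inj₂ (i , j , subst id (E-ˡʳ i j) e , inj₂ (∈-++ʳ⁻ S′
    (subst ((a ↑ʳ j) ∈_) (≡.sym eq) (y∈swap (S ++ Z) (i ↑ˡ b) (a ↑ʳ j)))))

-- Decision procedures for independence, domination and moves.

independent? : ∀ G S → Dec (Independent G S)
independent? G S = all? λ x → all? λ y → x ∈? S →-dec (y ∈? S →-dec ¬? (T? (adj G x y)))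

dominating? : ∀ G S → Dec (Dominating G S)
dominating? G S = all? λ v → v ∈? S ⊎-dec any? λ u → u ∈? S ×-dec T? (adj G u v)

indepDom? : ∀ G S → Dec (IndepDom G S)
indepDom? G S = independent? G S ×-dec dominating? G S

iSetAdj? : ∀ G S S′ → Dec (ISetAdj G S S′)
iSetAdj? G S S′ = any? λ x → any? λ y →
  T? (adj G x y) ×-dec (x ∈? S ×-dec (¬? (y ∈? S) ×-dec (S′ ≟ˢ swap S x y)))

-- Isomorphisms onto induced subgraphs of i-graphs

record Embedding {V : Set} (P : V → Set) (_~_ : V → V → Set) (G : Graph) : Set where
  field
    f         : V → Subset (n G)
    isISet    : ∀ {v} → P v → IsISet G (f v)
    injective : ∀ {u v} → P u → P v → f u ≡ f v → u ≡ v
    adj⇔      : ∀ {u v} → P u → P v → (u ~ v) ⇔ ISetAdj G (f u) (f v)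

open Embedding

-- An embedding need not reach every i-set, so `g` may miss vertices. This covers both induced
-- subgraphs and copies inside products.
pullback : ∀ {V W : Set} {P : V → Set} {Q : W → Set} {_~_ : V → V → Set} {_≈_ : W → W → Set} {G} →
  Embedding P _~_ G → (g : W → V) → (∀ {w} → Q w → P (g w)) →
  (∀ {w w′} → Q w → Q w′ → g w ≡ g w′ → w ≡ w′) →
  (∀ {w w′} → Q w → Q w′ → (w ≈ w′) ⇔ (g w ~ g w′)) → Embedding Q _≈_ G
pullback e g gP g-inj g-adj = record
  { f         = f e ∘ g
  ; isISet    = isISet e ∘ gP
  ; injective = λ q q′ eq → g-inj q q′ (injective e (gP q) (gP q′) eq)
  ; adj⇔      = λ q q′ → mk⇔ (to (adj⇔ e (gP q) (gP q′)) ∘ to (g-adj q q′))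
                              (from (g-adj q q′) ∘ from (adj⇔ e (gP q) (gP q′)))
  }

-- Cartesian products of i-graphs.

_□_ : ∀ {V W : Set} → (V → V → Set) → (W → W → Set) → V × W → V × W → Set
(_~_ □ _≈_) (u , w) (u′ , w′) = (u ~ u′ × w ≡ w′) ⊎ (u ≡ u′ × w ≈ w′)

_⊠_ : ∀ {V W : Set} → (V → Set) → (W → Set) → V × W → Set
(P ⊠ Q) (v , w) = P v × Q w

-- In a disjoint union, cardinalities of the two parts add, so two minimum sets form a minimum set.
-- A move takes place on one side only, which is adjacency in the Cartesian product.
product : ∀ {V W : Set} {P : V → Set} {Q : W → Set} {_~_ : V → V → Set} {_≈_ : W → W → Set} {G₁ G₂} →
  Embedding P _~_ G₁ → Embedding Q _≈_ G₂ → ∃[ G ] Embedding (P ⊠ Q) (_~_ □ _≈_) G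
product {V} {W} {P} {Q} {_~_} {_≈_} {G₁} {G₂} e₁ e₂ = J , record
  { f         = F
  ; isISet    = λ (p , q) → iset (isISet e₁ p) (isISet e₂ q)
  ; injective = λ {(v , w)} {(v′ , w′)} (p , q) (p′ , q′) eq →
      let eq₁ , eq₂ = ++-injective (f e₁ v) (f e₁ v′) eq
      in cong₂ _,_ (injective e₁ p p′ eq₁) (injective e₂ q q′ eq₂)
  ; adj⇔      = λ (p , q) (p′ , q′) → mk⇔ (adj⇒ p q p′ q′) (adj⇐ p q p′ q′)
  }
  where
  open Join G₁ G₂ (λ _ _ → false)

  F : V × W → Subset (n J)
  F (v , w) = f e₁ v ++ f e₂ w

  iset : ∀ {S Z} → IsISet G₁ S → IsISet G₂ Z → IsISet J (S ++ Z)
  iset {S} {Z} ((indS , domS) , minS) ((indZ , domZ) , minZ) =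
    (independent⁺ indS indZ (λ _ _ _ _ ()) , dominating⁺ (inj₁ ∘ domS) (inj₁ ∘ domZ)) , minimal
    where
    minimal : ∀ T → IndepDom J T → ∣ S ++ Z ∣ ≤ ∣ T ∣
    minimal T (ind , dom) with Vec.splitAt (n G₁) T
    -- Without cross edges each part must dominate its own side, so the two minima apply separately.
    ... | S′ , Z′ , refl rewrite ∣++∣ S Z | ∣++∣ S′ Z′ = +-mono-≤
      (minS S′ (independentˡ ind , λ i → [ id , (λ ()) ]′ (dominatingˡ dom i)))
      (minZ Z′ (independentʳ {S = S′} ind , λ j → [ id , (λ ()) ]′ (dominatingʳ {S = S′} dom j)))

  module _ {v w v′ w′} (p : P v) (q : Q w) (p′ : P v′) (q′ : Q w′) where

    adj⇒ : (_~_ □ _≈_) (v , w) (v′ , w′) → ISetAdj J (F (v , w)) (F (v′ , w′))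
    adj⇒ (inj₁ (v~v′ , refl)) = iSetAdj-++ˡ (to (adj⇔ e₁ p p′) v~v′)
    adj⇒ (inj₂ (refl , w≈w′)) = iSetAdj-++ʳ (to (adj⇔ e₂ q q′) w≈w′)

    adj⇐ : ISetAdj J (F (v , w)) (F (v′ , w′)) → (_~_ □ _≈_) (v , w) (v′ , w′)
    adj⇐ A with iSetAdj-++⁻ A
    ... | inj₁ (inj₁ (A₁ , eq)) = inj₁ (from (adj⇔ e₁ p p′) A₁ , injective e₂ q q′ eq)
    ... | inj₁ (inj₂ (eq , A₂)) = inj₂ (injective e₁ p p′ eq , from (adj⇔ e₂ q q′) A₂)

-- Destroying unwanted i-sets.

complete : ℕ → Graph
complete k = record
  { n      = k
  ; adj    = λ x y → Dec.does (¬? (x ≟ y))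
  ; sym    = λ x y → cong not (does-sym x y)
  ; irrefl = λ x → cong not (does-refl x)
  }
  where
  does-refl : ∀ x → Dec.does (x ≟ x) ≡ true
  does-refl x with x ≟ x
  ... | yes _  = refl
  ... | no x≢x = contradiction refl x≢x
  does-sym : ∀ x y → Dec.does (x ≟ y) ≡ Dec.does (y ≟ x)
  does-sym x y with x ≟ y | y ≟ x
  ... | yes _   | yes _   = refl
  ... | no _    | no _    = refl
  ... | yes x≡y | no y≢x  = contradiction (≡.sym x≡y) y≢x
  ... | no x≢y  | yes y≡x = contradiction (≡.sym y≡x) x≢y

complete-independent : ∀ {k} {Z : Subset k} → Independent (complete k) Z →
  ∀ {i j} → i ∈ Z → j ∈ Z → i ≡ j
complete-independent ind {i} {j} i∈ j∈ with i ≟ j | ind i j i∈ j∈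
... | yes i≡j | _  = i≡j
... | no _    | ¬e = contradiction tt ¬e

∉⇒T-not-lookup : ∀ {k} {X : Subset k} {i} → i ∉ X → T (not (lookup X i))
∉⇒T-not-lookup {X = X} {i} i∉ with lookup X i in eq
... | true  = i∉ (lookup⇒[]= i X eq)
... | false = tt

T-not-lookup⇒∉ : ∀ {k} {X : Subset k} {i} → T (not (lookup X i)) → i ∉ X
T-not-lookup⇒∉ t i∈ rewrite []=⇒lookup i∈ = t

-- Each unwanted i-set X is destroyed by a new vertex adjacent to exactly the
-- vertices outside X: X no longer dominates it, while every other i-set does.
-- Joining the new vertices into a clique keeps the independent dominating sets
-- that use one of them too large.
module Deletion (G : Graph) {l : ℕ} (X : Fin l → Subset (n G)) where

  open Join G (complete l) (λ i j → not (lookup (X j) i)) public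

  -- New vertex `j` has a neighbour in `S` exactly when `S` is not contained in `X j`.
  indepDom⁺ : ∀ {S} → IndepDom G S → (∀ j → ¬ (S ⊆ X j)) → IndepDom J (S ++ ⊥)
  indepDom⁺ {S} (ind , dom) S⊈X =
    independent⁺ ind (λ _ _ j∈⊥ → contradiction j∈⊥ ∉⊥) (λ _ _ _ j∈⊥ → contradiction j∈⊥ ∉⊥) ,
    dominating⁺ (inj₁ ∘ dom) λ j → inj₂ (outside-X j)
    where
    outside-X : ∀ j → ∃[ i ] (i ∈ S × T (not (lookup (X j) i)))
    outside-X j with any? (λ i → i ∈? S ×-dec ¬? (i ∈? X j))
    ... | yes (i , i∈S , i∉X) = i , i∈S , ∉⇒T-not-lookup i∉X
    ... | no none             = contradiction
      (λ {i} i∈S → decidable-stable (i ∈? X j) λ i∉X → none (i , i∈S , i∉X)) (S⊈X j)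

  indepDom-⊥⁻ : ∀ {S} → IndepDom J (S ++ ⊥) → IndepDom G S
  indepDom-⊥⁻ {S} (ind , dom) = independentˡ ind , λ i →
    [ id , (λ (_ , j∈⊥ , _) → contradiction j∈⊥ ∉⊥) ]′ (dominatingˡ {S = S} dom i)

  -- With no new vertex chosen, vertex `j` can be dominated only by a member of `S` outside `X j`.
  ⊈X : ∀ {S} → IndepDom J (S ++ ⊥) → ∀ j → ¬ (S ⊆ X j)
  ⊈X {S} (_ , dom) j S⊆X with dominatingʳ {S = S} dom j
  ... | inj₁ (inj₁ j∈⊥)           = ∉⊥ j∈⊥
  ... | inj₁ (inj₂ (_ , u∈⊥ , _)) = ∉⊥ u∈⊥
  ... | inj₂ (i , i∈S , t)        = T-not-lookup⇒∉ t (S⊆X i∈S)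

  -- Choosing new vertex `j` confines `S` to `X j` by independence, and yet no vertex of `X j` can
  -- be dominated without belonging to `S`. Hence `S` is all of `X j`, and `Z` adds at least one
  -- more vertex.
  new-vertex-large : ∀ {S Z j} → Independent G (X j) → IndepDom J (S ++ Z) → j ∈ Z → ∣ X j ∣ < ∣ S ++ Z ∣
  new-vertex-large {S} {Z} {j} indX (ind , dom) j∈Z = begin-strict
    ∣ X j ∣       ≤⟨ p⊆q⇒∣p∣≤∣q∣ X⊆S ⟩
    ∣ S ∣         <⟨ ≤-reflexive (+-comm 1 ∣ S ∣) ⟩
    ∣ S ∣ + 1     ≤⟨ +-monoʳ-≤ ∣ S ∣ (nonempty⇒1≤∣p∣ j∈Z) ⟩
    ∣ S ∣ + ∣ Z ∣ ≡⟨ ∣++∣ S Z ⟨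
    ∣ S ++ Z ∣    ∎
    where
    open ≤-Reasoning
    S⊆X : S ⊆ X j
    S⊆X {i} i∈S = decidable-stable (i ∈? X j) λ i∉X →
      independent-cross ind i∈S j∈Z (∉⇒T-not-lookup i∉X)
    X⊆S : X j ⊆ S
    X⊆S {i} i∈X with dominatingˡ dom i
    ... | inj₁ (inj₁ i∈S)             = i∈S
    ... | inj₁ (inj₂ (u , u∈S , edge)) = contradiction edge (indX u i (S⊆X u∈S) i∈X)
    -- The clique admits only one chosen new vertex, so `j′` is `j`, which has no neighbour in
    -- `X j`.
    ... | inj₂ (j′ , j′∈Z , t) with complete-independent (independentʳ {S = S} ind) j∈Z j′∈Z
    ...   | refl = contradiction i∈X (T-not-lookup⇒∉ t)

  ∣++⊥∣ : ∀ (S : Subset (n G)) → ∣ S ++ ⊥ {l} ∣ ≡ ∣ S ∣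
  ∣++⊥∣ S = trans (∣++∣ S ⊥) (trans (cong (∣ S ∣ +_) (∣⊥∣≡0 (l))) (+-identityʳ ∣ S ∣))

-- Induced subgraphs of i-graphs.

module _ (H : Graph) (B : Subset (n H)) {G : Graph}
         (e : Embedding (_∈ B) (E H) G) {v₀ : Fin (n H)} (v₀∈B : v₀ ∈ B) where

  private
    InImage : Subset (n G) → Set
    InImage X = ∃[ v ] (v ∈ B × f e v ≡ X)

    inImage? : ∀ X → Dec (InImage X)
    inImage? X = any? λ v → v ∈? B ×-dec (f e v ≟ˢ X)

    Unwanted : Subset (n G) → Set
    Unwanted X = IsISet G X × ¬ InImage X

    -- The image of `v₀` is an i-set, so its cardinality is `i(G)`, and being an i-set reduces to a
    -- decidable comparison with it.
    i-min : ∀ T → IndepDom G T → ∣ f e v₀ ∣ ≤ ∣ T ∣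
    i-min = proj₂ (isISet e v₀∈B)

    isISet⁺ : ∀ {S} → IndepDom G S → ∣ S ∣ ≤ ∣ f e v₀ ∣ → IsISet G S
    isISet⁺ indDom ∣S∣≤ = indDom , λ T indDomT → ≤-trans ∣S∣≤ (i-min T indDomT)

    isISet? : ∀ X → Dec (IsISet G X)
    isISet? X = map′ (λ (d , ∣X∣≤) → isISet⁺ d ∣X∣≤)
                     (λ (d , min) → d , min _ (proj₁ (isISet e v₀∈B)))
                     (indepDom? G X ×-dec (∣ X ∣ ≤? ∣ f e v₀ ∣))

    unwanted? : ∀ X → Dec (Unwanted X)
    unwanted? X = isISet? X ×-dec ¬? (inImage? X)

  module DeleteUnwanted {l} (X : Fin l → Subset (n G)) (X-unwanted : ∀ j → Unwanted (X j))
                        (X-complete : ∀ S → Unwanted S → ∃[ j ] S ≡ X j) where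

    open Deletion G X

    unwanted-large : ∀ {S Z j} → IndepDom J (S ++ Z) → j ∈ Z → ∣ f e v₀ ∣ < ∣ S ++ Z ∣
    unwanted-large {j = j} d j∈Z with X-unwanted j
    ... | ((indX , domX) , _) , _ =
      ≤-<-trans (i-min (X j) (indX , domX)) (new-vertex-large indX d j∈Z)

    F : Fin (n H) → Subset (n J)
    F v = f e v ++ ⊥

    F-indepDom : ∀ {v} → v ∈ B → IndepDom J (F v)
    -- An i-set contained in `X j` equals it by cardinality, which would put the unwanted `X j` into
    -- the image.
    F-indepDom {v} v∈B = indepDom⁺ (proj₁ (isISet e v∈B)) λ j f⊆X →
      proj₂ (X-unwanted j) (v , v∈B , p⊆q∧∣q∣≤∣p∣⇒p≡q f⊆X
        (proj₂ (proj₁ (X-unwanted j)) (f e v) (proj₁ (isISet e v∈B))))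

    F-isISet : ∀ v → v ∈ B → IsISet J (F v)
    F-isISet v v∈B = F-indepDom v∈B , minimal
      where
      f-min : ∀ T → IndepDom G T → ∣ F v ∣ ≤ ∣ T ∣
      f-min T d = subst (_≤ ∣ T ∣) (≡.sym (∣++⊥∣ (f e v))) (proj₂ (isISet e v∈B) T d)
      minimal : ∀ T → IndepDom J T → ∣ F v ∣ ≤ ∣ T ∣
      minimal T d with Vec.splitAt (n G) T
      ... | S , Z , refl with nonempty? Z
      ...   | yes (j , j∈Z) = ≤-trans (f-min (f e v₀) (proj₁ (isISet e v₀∈B))) (<⇒≤ (unwanted-large d j∈Z))
      ...   | no empty with Empty-unique {p = Z} empty
      ...     | refl = subst (∣ F v ∣ ≤_) (≡.sym (∣++⊥∣ S)) (f-min S (indepDom-⊥⁻ d))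

    -- An i-set of `J` is no larger than `F v₀`, so it uses no new vertex and its old part is an
    -- i-set of `G`. Outside the image that part would be some `X j`, which fails to dominate new
    -- vertex `j`.
    F-surjective : ∀ T → IsISet J T → ∃[ v ] (v ∈ B × F v ≡ T)
    F-surjective T (d , min) with Vec.splitAt (n G) T
    ... | S , Z , refl with nonempty? Z | subst (∣ S ++ Z ∣ ≤_) (∣++⊥∣ (f e v₀)) (min (F v₀) (F-indepDom v₀∈B))
    ...   | yes (j , j∈Z) | ∣T∣≤ = contradiction ∣T∣≤ (<⇒≱ (unwanted-large d j∈Z))
    ...   | no empty      | ∣T∣≤ with Empty-unique {p = Z} empty
    ...     | refl with inImage? S
    ...       | yes (v , v∈B , eq) = v , v∈B , cong (_++ ⊥) eq
    ...       | no S∉image with X-complete S (isISet⁺ (indepDom-⊥⁻ d) (subst (_≤ ∣ f e v₀ ∣) (∣++⊥∣ S) ∣T∣≤) , S∉image)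
    ...         | j , S≡X = contradiction (λ {i} → subst (i ∈_) S≡X) (⊈X d j)

    F-adj : ∀ u v → u ∈ B → v ∈ B → E H u v ⇔ ISetAdj J (F u) (F v)
    F-adj u v u∈B v∈B = mk⇔ (iSetAdj-++ˡ ∘ to (adj⇔ e u∈B v∈B)) (from (adj⇔ e u∈B v∈B) ∘ restrict)
      where
      restrict : ISetAdj J (F u) (F v) → ISetAdj G (f e u) (f e v)
      restrict A with iSetAdj-++⁻ A
      ... | inj₁ (inj₁ (A₁ , _))                       = A₁
      ... | inj₁ (inj₂ (_ , _ , _ , _ , x∈⊥ , _))      = contradiction x∈⊥ ∉⊥
      ... | inj₂ (_ , _ , _ , inj₁ j∈⊥)                = contradiction j∈⊥ ∉⊥
      ... | inj₂ (_ , _ , _ , inj₂ j∈⊥)                = contradiction j∈⊥ ∉⊥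

    realizes : IGraphIsoOn H B J
    realizes = F , F-isISet
      , (λ u v u∈B v∈B eq → injective e u∈B v∈B (proj₁ (++-injective (f e u) (f e v) eq)))
      , F-surjective , F-adj

  -- The surviving i-set of `v₀` keeps the minimum cardinality at `i(G)`, so destroying all unwanted
  -- i-sets at once leaves exactly the image of `B`.
  embedding⇒realizable : IRealizableOn H B
  embedding⇒realizable with enumerate unwanted?
  ... | _ , X , X-unwanted , X-complete = Deletion.J G X , DeleteUnwanted.realizes X X-unwanted X-complete

realizable⇒embedding : ∀ {H B} → ((G , _) : IRealizableOn H B) → Embedding (_∈ B) (E H) G
realizable⇒embedding (_ , F , iset , inj , _ , adj) = record
  { f = F ; isISet = iset _ ; injective = inj _ _ ; adj⇔ = adj _ _ }

-- Restricted to `C`, the isomorphism may miss i-sets; destroying those restores surjectivity.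
realizable-⊆ : ∀ {H B C} → IRealizableOn H B → C ⊆ B → Nonempty C → IRealizableOn H C
realizable-⊆ {H} {B} {C} r C⊆B (_ , v∈C) = embedding⇒realizable H C
  (pullback {_≈_ = E H} (realizable⇒embedding {H} {B} r) id C⊆B (λ _ _ → id) (λ _ _ → mk⇔ id id)) v∈C

-- Gluing realizable vertex sets.

-- The 4-cycle as K₂,₂, whose i-sets are its two nonadjacent sides.
C₄ : Graph
C₄ = record
  { n      = 4
  ; adj    = λ x y → side x xor side y
  ; sym    = λ x y → Bool.xor-comm (side x) (side y)
  ; irrefl = λ x → Bool.xor-same (side x)
  }
  where
  side : Fin 4 → Bool
  side x = Dec.does (x ∈? (true ∷ true ∷ false ∷ false ∷ []))

-- As a factor of a Cartesian product this keeps two copies apart: vertices with different Boolean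
-- coordinates are neither equal nor adjacent.
2K₁ : Embedding {Bool} (λ _ → T true) (λ _ _ → T false) C₄
2K₁ = record { f = F ; isISet = λ {v} _ → iset v , minimal v ; injective = λ {u} {v} _ _ → inj u v
             ; adj⇔ = λ {u} {v} _ _ → mk⇔ (λ ()) (λ A → ⊥-elim (nonadj u v A)) }
  where
  F : Bool → Subset 4
  F true  = true ∷ true ∷ false ∷ false ∷ []
  F false = false ∷ false ∷ true ∷ true ∷ []

  iset : ∀ v → IndepDom C₄ (F v)
  iset true  = from-yes (indepDom? C₄ (F true))
  iset false = from-yes (indepDom? C₄ (F false))

  -- An exhaustive search over the sixteen vertex sets settles the lower bound.
  i≥2 : ¬ (∃[ T ] (IndepDom C₄ T × ¬ (2 ≤ ∣ T ∣)))
  i≥2 = from-no (anySubset? λ T → indepDom? C₄ T ×-dec ¬? (2 ≤? ∣ T ∣))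

  minimal : ∀ v T → IndepDom C₄ T → ∣ F v ∣ ≤ ∣ T ∣
  minimal true  T d = decidable-stable (2 ≤? ∣ T ∣) λ ¬2≤ → i≥2 (T , d , ¬2≤)
  minimal false T d = decidable-stable (2 ≤? ∣ T ∣) λ ¬2≤ → i≥2 (T , d , ¬2≤)

  inj : ∀ u v → F u ≡ F v → u ≡ v
  inj true  true  _ = refl
  inj false false _ = refl

  nonadj : ∀ u v → ¬ ISetAdj C₄ (F u) (F v)
  nonadj true  true  = from-no (iSetAdj? C₄ (F true) (F true))
  nonadj true  false = from-no (iSetAdj? C₄ (F true) (F false))
  nonadj false true  = from-no (iSetAdj? C₄ (F false) (F true))
  nonadj false false = from-no (iSetAdj? C₄ (F false) (F false))

-- Disjoint vertex sets without edges between them sit in H₁ □ H₂ □ 2K₁ as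
-- H₁ × {v₂} × {true} and {v₁} × H₂ × {false}.
realizable-disjoint : ∀ {H B A C v₁ v₂} → IRealizableOn H A → IRealizableOn H C → v₁ ∈ A → v₂ ∈ C →
  A ⊆ B → (∀ {u} → u ∈ B → u ∉ A → u ∈ C) →
  (∀ {u w} → u ∈ A → w ∈ B → w ∉ A → ¬ E H u w) → IRealizableOn H B
realizable-disjoint {H} {B} {A} {C} {v₁} {v₂} rA rC v₁∈A v₂∈C A⊆B B∖A⊆C sep =
  embedding⇒realizable H B
    (pullback (proj₂ (product (proj₂ (product (realizable⇒embedding {H} {A} rA) (realizable⇒embedding {H} {C} rC))) 2K₁))
      g g∈ g-injective g-adj)
    (A⊆B v₁∈A)
  where
  g : Fin (n H) → (Fin (n H) × Fin (n H)) × Bool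
  g u with u ∈? A
  ... | yes _ = (u , v₂) , true
  ... | no _  = (v₁ , u) , false

  g∈ : ∀ {u} → u ∈ B → (((_∈ A) ⊠ (_∈ C)) ⊠ (λ _ → T true)) (g u)
  g∈ {u} u∈B with u ∈? A
  ... | yes u∈A = (u∈A , v₂∈C) , tt
  ... | no u∉A  = (v₁∈A , B∖A⊆C u∈B u∉A) , tt

  g-injective : ∀ {u w} → u ∈ B → w ∈ B → g u ≡ g w → u ≡ w
  g-injective {u} {w} _ _ eq with u ∈? A | w ∈? A
  g-injective _ _ refl | yes _ | yes _ = refl
  g-injective _ _ refl | no _  | no _  = refl

  g-adj : ∀ {u w} → u ∈ B → w ∈ B → E H u w ⇔ ((E H □ E H) □ (λ _ _ → T false)) (g u) (g w)
  g-adj {u} {w} u∈B w∈B with u ∈? A | w ∈? A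
  -- The images share their fixed coordinates, so an edge in the second factor would be a loop at
  -- `v₂`.
  ... | yes _   | yes _   = mk⇔ (λ uw → inj₁ (inj₁ (uw , refl) , refl))
    λ { (inj₁ (inj₁ (uw , _) , _)) → uw ; (inj₁ (inj₂ (_ , vv) , _)) → ⊥-elim (loopless H v₂ vv) }
  ... | yes u∈A | no w∉A  = mk⇔ (λ uw → ⊥-elim (sep u∈A w∈B w∉A uw)) λ { (inj₁ (_ , ())) ; (inj₂ (_ , ())) }
  ... | no u∉A  | yes w∈A = mk⇔ (λ uw → ⊥-elim (sep w∈A u∈B u∉A (E-sym H u w uw))) λ { (inj₁ (_ , ())) ; (inj₂ (_ , ())) }
  ... | no _    | no _    = mk⇔ (λ uw → inj₁ (inj₂ (refl , uw) , refl))
    λ { (inj₁ (inj₂ (_ , uw) , _)) → uw ; (inj₁ (inj₁ (vv , _) , _)) → ⊥-elim (loopless H v₁ vv) }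

-- Vertex sets meeting in v, with no other edges between them, sit in H₁ □ H₂ as
-- H₁ × {v} and {v} × H₂.
realizable-coalesce : ∀ {H B A C v} → IRealizableOn H A → IRealizableOn H C → v ∈ A → v ∈ C →
  A ⊆ B → (∀ {u} → u ∈ B → u ∉ A → u ∈ C) →
  (∀ {u w} → u ∈ A → w ∈ B → w ∉ A → E H u w → u ≡ v) → IRealizableOn H B
realizable-coalesce {H} {B} {A} {C} {v} rA rC v∈A v∈C A⊆B B∖A⊆C sep =
  embedding⇒realizable H B
    (pullback (proj₂ (product (realizable⇒embedding {H} {A} rA) (realizable⇒embedding {H} {C} rC)))
      g g∈ g-injective g-adj)
    (A⊆B v∈A)
  where
  g : Fin (n H) → Fin (n H) × Fin (n H)
  g u with u ∈? A
  ... | yes _ = u , v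
  ... | no _  = v , u

  g∈ : ∀ {u} → u ∈ B → ((_∈ A) ⊠ (_∈ C)) (g u)
  g∈ {u} u∈B with u ∈? A
  ... | yes u∈A = u∈A , v∈C
  ... | no u∉A  = v∈A , B∖A⊆C u∈B u∉A

  g-injective : ∀ {u w} → u ∈ B → w ∈ B → g u ≡ g w → u ≡ w
  g-injective {u} {w} _ _ eq with u ∈? A | w ∈? A
  g-injective _ _ refl | yes _ | yes _ = refl
  g-injective _ _ refl | no _  | no _  = refl
  -- Images from opposite sides can agree only at `(v , v)`, which makes both vertices equal to `v`.
  g-injective _ _ refl | yes _ | no _  = refl
  g-injective _ _ refl | no _  | yes _ = refl

  g-adj : ∀ {u w} → u ∈ B → w ∈ B → E H u w ⇔ (E H □ E H) (g u) (g w)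
  g-adj {u} {w} u∈B w∈B with u ∈? A | w ∈? A
  ... | yes _   | yes _   = mk⇔ (λ uw → inj₁ (uw , refl))
    λ { (inj₁ (uw , _)) → uw ; (inj₂ (_ , vv)) → ⊥-elim (loopless H v vv) }
  -- An edge leaving `A` starts at `v`, so both images have first coordinate `v` and the edge lies
  -- in the second factor. An edge in the first factor would give `w ≡ v`, putting `w` in `A`.
  ... | yes u∈A | no w∉A  = mk⇔ (λ uw → inj₂ (sep u∈A w∈B w∉A uw , subst (λ x → E H x w) (sep u∈A w∈B w∉A uw) uw))
    λ { (inj₁ (_ , refl)) → contradiction v∈A w∉A ; (inj₂ (refl , uw)) → uw }
  ... | no u∉A  | yes w∈A = mk⇔
    (λ uw → let w≡v = sep w∈A u∈B u∉A (E-sym H u w uw) in inj₂ (≡.sym w≡v , subst (E H u) w≡v uw))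
    λ { (inj₁ (_ , refl)) → contradiction v∈A u∉A ; (inj₂ (refl , uw)) → uw }
  ... | no _    | no _    = mk⇔ (λ uw → inj₂ (refl , uw))
    λ { (inj₂ (_ , uw)) → uw ; (inj₁ (vv , _)) → ⊥-elim (loopless H v vv) }

-- Connectivity and blocks

module _ (H : Graph) where

  AllPaths : Subset (n H) → Set
  AllPaths B = ∀ x y → x ∈ B → y ∈ B → PathIn H B x y

  -- For `A ⊆ B` this makes `A` a union of components of the subgraph induced by `B`.
  Closed : Subset (n H) → Subset (n H) → Set
  Closed B A = ∀ {a b} → a ∈ A → b ∈ B → E H a b → b ∈ A

  -- Disconnection is recorded by an explicit part `A`, since the induction on `B` needs that part
  -- in order to split.
  Separated : Subset (n H) → Set
  Separated B = ∃[ A ] (A ⊆ B × Closed B A × Nonempty A × (∃[ y ] (y ∈ B × y ∉ A)))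

  path-source : ∀ {B x y} → PathIn H B x y → x ∈ B
  path-source (here x∈B)     = x∈B
  path-source (step x∈B _ _) = x∈B

  path-snoc : ∀ {B x y z} → PathIn H B x y → E H y z → z ∈ B → PathIn H B x z
  path-snoc (here x∈B)       xz z∈B = step x∈B xz (here z∈B)
  path-snoc (step x∈B xw p) yz z∈B = step x∈B xw (path-snoc p yz z∈B)

  path-closed : ∀ {B A x y} → Closed B A → x ∈ A → PathIn H B x y → y ∈ A
  path-closed closed x∈A (here _)      = x∈A
  path-closed closed x∈A (step _ xw p) = path-closed closed (closed x∈A (path-source p) xw) p

  -- Starting from `x`, the far end of an edge leaving the current set is added repeatedly. Each
  -- addition enlarges the set strictly, so growth ends, and it ends only when no edge leaves it
  -- inside `B`.
  component : ∀ {B x} → x ∈ B →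
    ∃[ A ] (x ∈ A × A ⊆ B × (∀ {y} → y ∈ A → PathIn H B x y) × Closed B A)
  component {B} {x} x∈B = grow ⁅ x ⁆ (⊃-wellFounded _) (x∈⁅x⁆ x)
    λ y∈ → subst (PathIn H B x) (≡.sym (x∈⁅y⁆⇒x≡y x y∈)) (here x∈B)
    where
    path-target : ∀ {y z} → PathIn H B y z → z ∈ B
    path-target (here z∈B)   = z∈B
    path-target (step _ _ p) = path-target p

    grow : ∀ A → Acc _⊃_ A → x ∈ A → (∀ {y} → y ∈ A → PathIn H B x y) →
      ∃[ A ] (x ∈ A × A ⊆ B × (∀ {y} → y ∈ A → PathIn H B x y) × Closed B A)
    grow A (acc rec) x∈A paths
      with any? (λ a → any? λ b → a ∈? A ×-dec (b ∈? B ×-dec (T? (adj H a b) ×-dec ¬? (b ∈? A))))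
    ... | no none = A , x∈A , path-target ∘ paths , paths , λ {a} {b} a∈A b∈B ab →
      decidable-stable (b ∈? A) λ b∉A → none (a , b , a∈A , b∈B , ab , b∉A)
    ... | yes (a , b , a∈A , b∈B , ab , b∉A) =
      grow (A ∪ ⁅ b ⁆) (rec (p⊆p∪q ⁅ b ⁆ , b , q⊆p∪q A _ (x∈⁅x⁆ b) , b∉A)) (p⊆p∪q ⁅ b ⁆ x∈A) paths′
      where
      paths′ : ∀ {y} → y ∈ A ∪ ⁅ b ⁆ → PathIn H B x y
      paths′ y∈ with x∈p∪q⁻ A ⁅ b ⁆ y∈
      ... | inj₁ y∈A = paths y∈A
      ... | inj₂ y∈b with x∈⁅y⁆⇒x≡y b y∈b
      ...   | refl = path-snoc (paths a∈A) ab b∈B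

  -- Reachability from `x` within `B` is membership in the component of `x`.
  path? : ∀ B x y → Dec (PathIn H B x y)
  path? B x y with x ∈? B
  ... | no x∉B  = no (x∉B ∘ path-source)
  ... | yes x∈B with component x∈B
  ...   | A , x∈A , _ , paths , closed = map′ paths (path-closed closed x∈A) (y ∈? A)

  separated⇒¬allPaths : ∀ {B} → Separated B → ¬ AllPaths B
  separated⇒¬allPaths (A , A⊆B , closed , (x , x∈A) , y , y∈B , y∉A) all =
    y∉A (path-closed closed x∈A (all x y (A⊆B x∈A) y∈B))

  ¬path⇒separated : ∀ {B x y} → x ∈ B → y ∈ B → ¬ PathIn H B x y → Separated B
  ¬path⇒separated {y = y} x∈B y∈B ¬p with component x∈B
  ... | A , x∈A , A⊆B , paths , closed = A , A⊆B , closed , (_ , x∈A) , y , y∈B , ¬p ∘ paths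

  ¬separated⇒allPaths : ∀ {B} → ¬ Separated B → AllPaths B
  ¬separated⇒allPaths ¬sep x y x∈B y∈B =
    decidable-stable (path? _ x y) (¬sep ∘ ¬path⇒separated x∈B y∈B)

  separated? : ∀ B → Dec (Separated B)
  separated? B with any? (λ x → any? λ y → x ∈? B ×-dec (y ∈? B ×-dec ¬? (path? B x y)))
  ... | yes (x , y , x∈B , y∈B , ¬p) = yes (¬path⇒separated x∈B y∈B ¬p)
  ... | no none = no λ sep → separated⇒¬allPaths sep λ x y x∈B y∈B →
    decidable-stable (path? B x y) λ ¬p → none (x , y , x∈B , y∈B , ¬p)

  allPaths? : ∀ B → Dec (AllPaths B)
  allPaths? B = map′ ¬separated⇒allPaths (λ all sep → separated⇒¬allPaths sep all) (¬? (separated? B))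

  nonseparable? : ∀ B → Dec (Nonseparable H B)
  nonseparable? B = (nonempty? B ×-dec allPaths? B) ×-dec all? λ v → v ∈? B →-dec allPaths? (B - v)

  -- Passing to strictly larger nonseparable sets must end by finiteness, and the last one is
  -- maximal.
  nonseparable⊆block : ∀ C → Nonseparable H C → ∃[ B ] (C ⊆ B × IsBlock H B)
  nonseparable⊆block C = extend C (⊃-wellFounded C)
    where
    extend : ∀ C → Acc _⊃_ C → Nonseparable H C → ∃[ B ] (C ⊆ B × IsBlock H B)
    extend C (acc rec) nonsep with anySubset? (λ D → C ⊂? D ×-dec nonseparable? D)
    ... | yes (D , C⊂D , nonsepD) =
      let B , D⊆B , block = extend D (rec C⊂D) nonsepD in B , D⊆B ∘ proj₁ C⊂D , block
    ... | no none = C , id , nonsep , λ D C⊆D nonsepD → ⊆-antisym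
      (λ {x} x∈D → decidable-stable (x ∈? C) λ x∉C → none (D , (C⊆D , x , x∈D , x∉C) , nonsepD))
      C⊆D

  -- Induction on strict inclusion: a disconnection or a cut vertex splits `B` into two smaller
  -- nonempty pieces, and if there is neither then `B` is nonseparable.
  realizable-nonempty : (∀ C → Nonseparable H C → IRealizableOn H C) → ∀ B → Nonempty B → IRealizableOn H B
  realizable-nonempty base B = go B (⊂-wellFounded B)
    where
    go : ∀ B → Acc _⊂_ B → Nonempty B → IRealizableOn H B
    go B (acc rec) B≢∅ with separated? B | any? (λ v → v ∈? B ×-dec separated? (B - v))
    -- Both pieces are proper subsets of `B`: `A` misses `y`, and its complement in `B` misses `x`.
    ... | yes (A , A⊆B , closed , (x , x∈A) , y , y∈B , y∉A) | _ =
      realizable-disjoint {H} {B} {A} {B ∩ ∁ A}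
        (go A (rec (A⊆B , y , y∈B , y∉A)) (x , x∈A))
        (go (B ∩ ∁ A) (rec (p∩q⊆p B (∁ A) , x , A⊆B x∈A , λ x∈ → x∈∁p⇒x∉p (p∩q⊆q B (∁ A) x∈) x∈A)) (y , y∈C))
        x∈A y∈C A⊆B (λ u∈B u∉A → x∈p∩q⁺ (u∈B , x∉p⇒x∈∁p u∉A))
        (λ u∈A w∈B w∉A uw → w∉A (closed u∈A w∈B uw))
      where
      y∈C : y ∈ B ∩ ∁ A
      y∈C = x∈p∩q⁺ (y∈B , x∉p⇒x∈∁p y∉A)
    -- Both pieces contain the cut vertex: it is added to `A`, and it lies in `B ∩ ∁ A` because
    -- `A ⊆ B - v`.
    ... | no _ | yes (v , v∈B , A , A⊆B-v , closed , (x , x∈A) , y , y∈B-v , y∉A) =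
      realizable-coalesce {H} {B} {A ∪ ⁅ v ⁆} {B ∩ ∁ A}
        (go (A ∪ ⁅ v ⁆) (rec (A∪v⊆B , y , B-v⊆B y∈B-v , y∉A∪v)) (v , v∈A∪v))
        (go (B ∩ ∁ A) (rec (p∩q⊆p B (∁ A) , x , B-v⊆B (A⊆B-v x∈A) , λ x∈ → x∈∁p⇒x∉p (p∩q⊆q B (∁ A) x∈) x∈A)) (v , v∈C))
        v∈A∪v v∈C A∪v⊆B (λ u∈B u∉ → x∈p∩q⁺ (u∈B , x∉p⇒x∈∁p (u∉ ∘ p⊆p∪q ⁅ v ⁆))) cut
      where
      B-v⊆B : B - v ⊆ B
      B-v⊆B = p─q⊆p B ⁅ v ⁆

      v∈A∪v : v ∈ A ∪ ⁅ v ⁆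
      v∈A∪v = q⊆p∪q A ⁅ v ⁆ (x∈⁅x⁆ v)

      A∪v⊆B : A ∪ ⁅ v ⁆ ⊆ B
      A∪v⊆B u∈ with x∈p∪q⁻ A ⁅ v ⁆ u∈
      ... | inj₁ u∈A = B-v⊆B (A⊆B-v u∈A)
      ... | inj₂ u∈v = subst (_∈ B) (≡.sym (x∈⁅y⁆⇒x≡y v u∈v)) v∈B

      y∉A∪v : y ∉ A ∪ ⁅ v ⁆
      y∉A∪v y∈ with x∈p∪q⁻ A ⁅ v ⁆ y∈
      ... | inj₁ y∈A = y∉A y∈A
      ... | inj₂ y∈v = x∈p-y⇒x≢y {p = B} y∈B-v (x∈⁅y⁆⇒x≡y v y∈v)

      v∈C : v ∈ B ∩ ∁ A
      v∈C = x∈p∩q⁺ (v∈B , x∉p⇒x∈∁p λ v∈A → x∈p-y⇒x≢y {p = B} (A⊆B-v v∈A) refl)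

      cut : ∀ {u w} → u ∈ A ∪ ⁅ v ⁆ → w ∈ B → w ∉ A ∪ ⁅ v ⁆ → E H u w → u ≡ v
      cut {u} {w} u∈ w∈B w∉ uw with x∈p∪q⁻ A ⁅ v ⁆ u∈
      ... | inj₂ u∈v = x∈⁅y⁆⇒x≡y v u∈v
      ... | inj₁ u∈A = contradiction (p⊆p∪q ⁅ v ⁆ (closed u∈A w∈B-v uw)) w∉
        where
        -- `A` is closed only within `B - v`; the vertex `w` qualifies since it lies outside
        -- `A ∪ ⁅ v ⁆`.
        w∈B-v : w ∈ B - v
        w∈B-v = x∈p∧x≢y⇒x∈p-y w∈B λ { refl → w∉ v∈A∪v }
    ... | no ¬sep | no ¬cut = base B
      ( (B≢∅ , ¬separated⇒allPaths ¬sep)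
      , λ v v∈B → ¬separated⇒allPaths λ sep → ¬cut (v , v∈B , sep))

theorem5p11 : (H : Graph) → n H ≥ 1 →
    IRealizable H ⇔ (∀ B → IsBlock H B → IRealizableOn H B)
theorem5p11 H n≥1 = mk⇔
  (λ r B (((B≢∅ , _) , _) , _) → realizable-⊆ {H} {⊤} {B} r ⊆⊤ B≢∅)
  -- Each nonseparable set inherits realizability from a block containing it.
  λ blocks → realizable-nonempty H
    (λ C nonsep@((C≢∅ , _) , _) →
      let B , C⊆B , block = nonseparable⊆block H C nonsep
      in realizable-⊆ {H} {B} {C} (blocks B block) C⊆B C≢∅)
    ⊤ (fromℕ< n≥1 , ∈⊤)
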